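{- Let $n \ge 1$ and let $T_R=([n], E_{red})$ and $T_B=([n], E_{blue})$ be two tournaments (a red one and a blue one) on the same vertex set $[n]$. Then there is a vertex $\nu \in [n]$ such that every $j\in[n]$ is reachable from $\nu$ by a rainbow directed path of length at most $2$.
   Context: $[n]=\{1,\dots,n\}$. A tournament $T=([n],E)$ is a directed graph without loops on vertex set $[n]$ such that for every two distinct vertices $i,j$ exactly one of $(i,j)$, $(j,i)$ belongs to $E$. The edges in $E_{red}$ are colored red and the edges in $E_{blue}$ are colored blue; the two tournaments are arbitrary, and a pair $(i,j)$ may be both a red edge and a blue edge. A directed path using edges of $T_R$ and $T_B$ is rainbow if its edges have pairwise different colors. Thus $j$ is reachable from $\nu$ by a rainbow directed path of length at most $2$ if and only if $j=\nu$ (path of length $0$), or $(\nu,j)\in E_{red}$, or $(\nu,j)\in E_{blue}$, or there is $k$ with $(\nu,k)\in E_{red}$ and $(k,j)\in E_{blue}$, or there is $k$ with $(\nu,k)\in E_{blue}$ and $(k,j)\in E_{red}$. -}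

module Defs where

open import Data.Empty using (⊥-elim)
open import Data.Fin using (Fin)
open import Data.Fin.Properties using (_≟_)
open import Data.List using (List; []; _∷_)
open import Data.List.Relation.Unary.All using ([]; _∷_)
open import Data.List.Relation.Unary.AllPairs using ([]; _∷_)
open import Data.List.Relation.Unary.Unique.Propositional using (Unique)
open import Data.Nat using (ℕ; zero; suc; _≤_; z≤n; s≤s)
open import Data.Product using (Σ; _×_; _,_; ∃-syntax)
open import Data.Sum using (_⊎_; inj₁; inj₂)
open import Function.Bundles using (_⇔_; mk⇔)
open import Relation.Binary.PropositionalEquality using (_≡_; _≢_; refl)
open import Relation.Nullary using (¬_; yes; no)

-- `exactlyOne` and `loopless` together make `E` decidable, so a Set-valued
-- edge relation carries no more generality than a Bool-valued one.
record Tournament (n : ℕ) : Set₁ where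
  field
    E          : Fin n → Fin n → Set
    loopless   : ∀ i → ¬ E i i
    exactlyOne : ∀ i j → i ≢ j → (E i j × ¬ E j i) ⊎ (E j i × ¬ E i j)

data Colour : Set where
  red blue : Colour

module _ {n : ℕ} (TR TB : Tournament n) where

  -- The same pair may be an edge in both colours.
  Edge : Colour → Fin n → Fin n → Set
  Edge red  = Tournament.E TR
  Edge blue = Tournament.E TB

  data Walk : Fin n → Fin n → Set where
    stop : ∀ {i} → Walk i i
    step : ∀ {i k j} (c : Colour) → Edge c i k → Walk k j → Walk i j

  length : ∀ {i j} → Walk i j → ℕ
  length stop         = zero
  length (step _ _ w) = suc (length w)

  colours : ∀ {i j} → Walk i j → List Colour
  colours stop         = []
  colours (step c _ w) = c ∷ colours w

  vertices : ∀ {i j} → Walk i j → List (Fin n)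
  vertices {i} stop         = i ∷ []
  vertices {i} (step _ _ w) = i ∷ vertices w

  IsPath : ∀ {i j} → Walk i j → Set
  IsPath w = Unique (vertices w)

  Rainbow : ∀ {i j} → Walk i j → Set
  Rainbow w = Unique (colours w)

  RainbowReachableWithin : ℕ → Fin n → Fin n → Set
  RainbowReachableWithin d ν j =
    Σ (Walk ν j) λ w → IsPath w × Rainbow w × length w ≤ d

  Edge-irrefl : ∀ c {i j} → Edge c i j → i ≢ j
  Edge-irrefl red  e refl = Tournament.loopless TR _ e
  Edge-irrefl blue e refl = Tournament.loopless TB _ e

  reachable-within-2 : ∀ ν j → RainbowReachableWithin 2 ν j ⇔
    ( j ≡ ν ⊎ Edge red ν j ⊎ Edge blue ν j
    ⊎ (∃[ k ] (Edge red ν k × Edge blue k j))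
    ⊎ (∃[ k ] (Edge blue ν k × Edge red k j)))
  reachable-within-2 ν j = mk⇔ to from
    where
    Cases : Set
    Cases = j ≡ ν ⊎ Edge red ν j ⊎ Edge blue ν j
          ⊎ (∃[ k ] (Edge red ν k × Edge blue k j))
          ⊎ (∃[ k ] (Edge blue ν k × Edge red k j))

    to : RainbowReachableWithin 2 ν j → Cases
    to (stop , _) = inj₁ refl
    to (step red  e stop , _) = inj₂ (inj₁ e)
    to (step blue e stop , _) = inj₂ (inj₂ (inj₁ e))
    to (step red  e (step blue f stop) , _) =
      inj₂ (inj₂ (inj₂ (inj₁ (_ , e , f))))
    to (step blue e (step red  f stop) , _) =
      inj₂ (inj₂ (inj₂ (inj₂ (_ , e , f))))
    to (step red  e (step red  f stop) , _ , (r≢r ∷ _) ∷ _ , _) =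
      ⊥-elim (r≢r refl)
    to (step blue e (step blue f stop) , _ , (b≢b ∷ _) ∷ _ , _) =
      ⊥-elim (b≢b refl)
    to (step _ _ (step _ _ (step _ _ _)) , _ , _ , s≤s (s≤s ()))

    one : ∀ c → Edge c ν j → RainbowReachableWithin 2 ν j
    one c e = step c e stop
            , (Edge-irrefl c e ∷ []) ∷ [] ∷ []
            , [] ∷ []
            , s≤s z≤n

    two : ∀ c d {k} → c ≢ d → Edge c ν k → Edge d k j →
          RainbowReachableWithin 2 ν j
    two c d c≢d e f with ν ≟ j
    ... | yes refl = stop , [] ∷ [] , [] , z≤n
    ... | no  ν≢j  = step c e (step d f stop)
                   , (Edge-irrefl c e ∷ ν≢j ∷ [])
                     ∷ (Edge-irrefl d f ∷ []) ∷ [] ∷ []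
                   , (c≢d ∷ []) ∷ [] ∷ []
                   , s≤s (s≤s z≤n)

    from : Cases → RainbowReachableWithin 2 ν j
    from (inj₁ refl)                                = stop , [] ∷ [] , [] , z≤n
    from (inj₂ (inj₁ e))                            = one red e
    from (inj₂ (inj₂ (inj₁ e)))                     = one blue e
    from (inj₂ (inj₂ (inj₂ (inj₁ (_ , e , f)))))    = two red blue (λ ()) e f
    from (inj₂ (inj₂ (inj₂ (inj₂ (_ , e , f)))))    = two blue red (λ ()) e f

{-# OPTIONS --safe #-}
-- Call k a common out-neighbour of i if i → k in both colours, and write
-- i ≺ j if i is a common out-neighbour of j and every common out-neighbour of i
-- is one of j.  This is a strict partial order.  If ν does not reach j, then
-- j → ν in both colours, and a red (blue) edge ν → k forces a blue (red) edge
-- j → k; hence ν ≺ j.  So any ≺-maximal vertex reaches every vertex.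
module Submission where

open import Data.Empty using (⊥-elim)
open import Data.Fin using (Fin; zero)
open import Data.Fin.Induction using (spo-noetherian)
open import Data.Fin.Properties using (_≟_; all?; any?; ¬∀⟶∃¬)
open import Data.Nat using (ℕ; suc; _≥_)
open import Data.Product using (∃-syntax; _×_; _,_)
open import Data.Sum using (inj₁; inj₂)
open import Defs
open import Function using (_∘_; flip)
open import Function.Bundles using (Equivalence)
open import Induction.WellFounded using (Acc; acc)
open import Relation.Binary.PropositionalEquality using (_≡_; _≢_; refl; sym; isEquivalence; resp₂)
open import Relation.Binary.Structures using (IsStrictPartialOrder)
open import Relation.Nullary using (Dec; ¬_; yes; no)
open import Relation.Nullary.Decidable using (map; _×-dec_; _⊎-dec_)
import Function.Properties.Equivalence as ⇔

module _ {n : ℕ} (T : Tournament n) where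
  open Tournament T

  E? : ∀ i j → Dec (E i j)
  E? i j with i ≟ j
  ... | yes refl = no (loopless i)
  ... | no i≢j with exactlyOne i j i≢j
  ...   | inj₁ (e , _) = yes e
  ...   | inj₂ (_ , ¬e) = no ¬e

  ¬E⇒E-reversed : ∀ {i j} → i ≢ j → ¬ E i j → E j i
  ¬E⇒E-reversed {i} {j} i≢j ¬e with exactlyOne i j i≢j
  ... | inj₁ (e , _) = ⊥-elim (¬e e)
  ... | inj₂ (e , _) = e

module _ {n : ℕ} (TR TB : Tournament n) where

  Common : Fin n → Fin n → Set
  Common i k = Edge TR TB red i k × Edge TR TB blue i k

  infix 4 _≺_

  _≺_ : Fin n → Fin n → Set
  i ≺ j = Common j i × (∀ k → Common i k → Common j k)

  -- `i ≺ i` would contain a loop at `i`. For transitivity, the inclusion from `j ≺ k` is applied to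
  -- `i` itself, a common out-neighbour of `j`.
  ≺-isStrictPartialOrder : IsStrictPartialOrder _≡_ _≺_
  ≺-isStrictPartialOrder = record
    { isEquivalence = isEquivalence
    ; irrefl        = λ { refl ((r , _) , _) → Tournament.loopless TR _ r }
    ; trans         = λ { (ji , i⊆j) (_ , j⊆k) →
                          j⊆k _ ji , λ l → j⊆k l ∘ i⊆j l }
    ; <-resp-≈      = resp₂ _≺_
    }

  -- Lets an unreached vertex be found constructively; the five-case form leaves only finite checks
  -- on edges.
  reachable? : ∀ ν j → Dec (RainbowReachableWithin TR TB 2 ν j)
  reachable? ν j = map (⇔.sym (reachable-within-2 TR TB ν j))
    ( (j ≟ ν) ⊎-dec E? TR ν j ⊎-dec E? TB ν j
    ⊎-dec any? (λ k → E? TR ν k ×-dec E? TB k j)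
    ⊎-dec any? (λ k → E? TB ν k ×-dec E? TR k j))

  unreachable⇒≺ : ∀ {ν j} → ¬ RainbowReachableWithin TR TB 2 ν j → ν ≺ j
  unreachable⇒≺ {ν} {j} unreachable = (jν-red , jν-blue) , common-⊆
    where
    open Equivalence (reachable-within-2 TR TB ν j) using (from)

    ν≢j : ν ≢ j
    ν≢j = unreachable ∘ from ∘ inj₁ ∘ sym

    ¬νj-red : ¬ Edge TR TB red ν j
    ¬νj-red = unreachable ∘ from ∘ inj₂ ∘ inj₁

    jν-red : Edge TR TB red j ν
    jν-red = ¬E⇒E-reversed TR ν≢j ¬νj-red

    jν-blue : Edge TR TB blue j ν
    jν-blue = ¬E⇒E-reversed TB ν≢j (unreachable ∘ from ∘ inj₂ ∘ inj₂ ∘ inj₁)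

    common-⊆ : ∀ k → Common ν k → Common j k
    common-⊆ k (r , b) =
        -- A red `k → j` after the blue `ν → k` would make `j` reachable; the second component swaps
        -- the colours.
        ¬E⇒E-reversed TR k≢j (λ e → unreachable (from (inj₂ (inj₂ (inj₂ (inj₂ (k , b , e)))))))
      , ¬E⇒E-reversed TB k≢j (λ e → unreachable (from (inj₂ (inj₂ (inj₂ (inj₁ (k , r , e)))))))
      where
      k≢j : k ≢ j
      k≢j refl = ¬νj-red r

  -- An unreached `j` lies strictly above `ν`, so the search climbs to `j`; hence the accessibility
  -- is for `flip _≺_`.
  reaches-all : ∀ ν → Acc (flip _≺_) ν →
    ∃[ μ ] (∀ j → RainbowReachableWithin TR TB 2 μ j)
  reaches-all ν (acc rec) with all? (reachable? ν)
  ... | yes reaches = ν , reaches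
  ... | no ¬reaches with ¬∀⟶∃¬ n _ (reachable? ν) ¬reaches
  ...   | j , unreachable = reaches-all j (rec (unreachable⇒≺ unreachable))

corollary3 : ∀ (n : ℕ) → n ≥ 1 → (TR TB : Tournament n) →
    ∃[ ν ] (∀ (j : Fin n) → RainbowReachableWithin TR TB 2 ν j)
corollary3 (suc n) _ TR TB =
  -- Finiteness of the vertex set makes every climb end; `zero` exists because `n ≥ 1`.
  reaches-all TR TB zero (spo-noetherian (≺-isStrictPartialOrder TR TB) zero)
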